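{- Let $\mathcal{I}$ be an ideal on $\omega$ that is Borel-separated from its dual filter $\mathcal{I}^\star$, i.e., there is a Borel set $S\subseteq 2^\omega$ such that $\mathcal{I}\subseteq S$ and $\mathcal{I}^\star\cap S=\emptyset$. Then $\mathfrak{b}(\mathcal{I})\leq\mathfrak{d}$. In particular, $\mathfrak{b}(\mathcal{I})\leq\mathfrak{d}$ for every analytic ideal $\mathcal{I}$.
   Context: An ideal on a set $X$ is a family $\mathcal{I}\subseteq\mathcal{P}(X)$ closed under finite unions and subsets, containing all finite subsets of $X$, and with $X\notin\mathcal{I}$. By "ideal" we mean an ideal on some countable set $X$. Its dual filter is $\mathcal{I}^\star=\{A\subseteq X: X\setminus A\in\mathcal{I}\}$. Subsets of $X$ are identified with their characteristic functions, so $\mathcal{P}(X)$ carries the topology of the Cantor space $\{0,1\}^X$; an ideal is analytic if it is an analytic subset of $\{0,1\}^X$. For an ideal $\mathcal{I}$ on a countable set $X$ and $f,g\in\omega^X$ write $f\leq_{\mathcal{I}}g$ if $\{x\in X: f(x)>g(x)\}\in\mathcal{I}$, let $\mathcal{D}_{\mathcal{I}}=\{f\in\omega^X: f^{ -1}[\{n\}]\in\mathcal{I}\text{ for every }n\in\omega\}$, and let $\mathfrak{b}(\mathcal{I})$ be the least cardinality of a family $\mathcal{F}\subseteq\mathcal{D}_{\mathcal{I}}$ such that there is no $g\in\mathcal{D}_{\mathcal{I}}$ with $g\leq_{\mathcal{I}}f$ for all $f\in\mathcal{F}$. Equivalently (a known characterization), $\mathfrak{b}(\mathcal{I})$ is the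 least cardinality of a family $\mathcal{E}$ of sequences $\langle E_n:n\in\omega\rangle$ of pairwise disjoint members of $\mathcal{I}$ such that for every sequence $\langle A_n:n\in\omega\rangle$ of pairwise disjoint members of $\mathcal{I}$ with $\bigcup_n A_n=X$ there is $\langle E_n\rangle\in\mathcal{E}$ with $\bigcup_{n\in\omega}\left(A_n\cap\bigcup_{i\leq n}E_i\right)\notin\mathcal{I}$. $\mathfrak{d}$ is the dominating number: the least size of a family $\mathcal{F}\subseteq\omega^\omega$ such that every $g\in\omega^\omega$ satisfies $g(n)\leq f(n)$ for all but finitely many $n$, for some $f\in\mathcal{F}$. -}

module Defs where

open import Level using (0ℓ; Setω)
open import Axiom.ExcludedMiddle using (ExcludedMiddle)
open import Axiom.Extensionality.Propositional using (Extensionality)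
open import Data.Bool using (Bool; true; false; not; _∨_; T)
open import Data.Nat using (ℕ; zero; suc; pred; _≤_; _<ᵇ_; _≡ᵇ_)
open import Data.Nat.Properties using (≤-refl; <⇒<ᵇ; n<1+n)
open import Data.List using (List)
open import Data.List.Membership.Propositional using () renaming (_∈_ to _∈ˡ_)
open import Data.List.Relation.Unary.All using (All)
open import Data.Empty using (⊥; ⊥-elim)
open import Data.Unit using (tt)
open import Data.Product using (Σ-syntax; ∃; ∃-syntax; _×_; _,_; proj₁; proj₂)
open import Data.Sum using (_⊎_; inj₁; inj₂)
open import Function using (_∘_)
open import Function.Bundles using (Injection; _⇔_)
open import Relation.Binary.Bundles using (Setoid)
open import Relation.Binary.PropositionalEquality
  using (_≡_; refl; sym; trans; cong; subst; _≗_; _→-setoid_)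
import Relation.Binary.Construct.On as On
open import Relation.Nullary using (¬_; yes; no; does)
open import Relation.Unary using (Pred; ∁; _∈_; _⊆_; _≐_; _∩_; ⋃; U; Empty)

-- The ambient classical set theory.  Excluded middle ranges over all
-- types, not only propositions, so together with Σ as existential
-- quantifier it also yields the axiom of choice.

record Classical : Setω where
  field
    em  : ∀ {ℓ} → ExcludedMiddle ℓ
    ext : ∀ {a b} → Extensionality a b

-- Subsets of X are points of the Cantor space {0,1}^X.

Subset : Set → Set
Subset X = X → Bool

record Ideal (X : Set) : Set₁ where
  field
    Mem      : Pred (Subset X) 0ℓ
    ∪-closed : ∀ {A B} → Mem A → Mem B → Mem (λ x → A x ∨ B x)
    ⊆-closed : ∀ {A B} → (∀ x → T (A x) → T (B x)) → Mem B → Mem A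
    finite   : ∀ {A} (xs : List X) → (∀ x → T (A x) → x ∈ˡ xs) → Mem A
    proper   : ¬ Mem (λ _ → true)

  Dual : Pred (Subset X) 0ℓ
  Dual A = Mem (λ x → not (A x))

open Ideal public using (Mem; Dual)

-- The product topology on D^X with D discrete; this covers both the
-- Cantor space {0,1}^X and the Baire space ω^ω.

IsOpen : {X D : Set} → Pred (X → D) 0ℓ → Set
IsOpen {X} P =
  ∀ a → P a → Σ[ xs ∈ List X ] (∀ b → All (λ x → b x ≡ a x) xs → P b)

-- The σ-algebra generated by the open sets.  Predicates are not
-- identified with their extensions, hence the closure under _≐_.

data Borel {X D : Set} : Pred (X → D) 0ℓ → Set₁ where
  isOpen : ∀ {P} → IsOpen P → Borel P
  compl  : ∀ {P} → Borel P → Borel (∁ P)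
  union  : ∀ {P : ℕ → Pred (X → D) 0ℓ} → (∀ n → Borel (P n)) → Borel (⋃ ℕ P)
  resp   : ∀ {P Q} → P ≐ Q → Borel P → Borel Q

Continuous : {X D Y E : Set} → ((X → D) → (Y → E)) → Set₁
Continuous φ = ∀ P → IsOpen P → IsOpen (λ a → P (φ a))

-- Analytic sets: ∅ and the continuous images of ω^ω.

Analytic : {X : Set} → Pred (Subset X) 0ℓ → Set₁
Analytic {X} P =
  Empty P ⊎
  (Σ[ φ ∈ ((ℕ → ℕ) → Subset X) ]
     Continuous φ × (∀ A → P A ⇔ (∃[ α ] φ α ≗ A)))

BorelSeparated : Ideal ℕ → Set₁
BorelSeparated I =
  Σ[ S ∈ Pred (Subset ℕ) 0ℓ ]
    Borel S × Mem I ⊆ S × Empty (Dual I ∩ S)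

Cardinal : Set₁
Cardinal = Setoid 0ℓ 0ℓ

infix 4 _≤ᶜ_

_≤ᶜ_ : Cardinal → Cardinal → Set
κ ≤ᶜ μ = Injection κ μ

-- The cardinality of a family of functions, where functions are
-- compared pointwise and membership proofs are ignored.

card : {X : Set} → Pred (X → ℕ) 0ℓ → Cardinal
card {X} F = On.setoid {B = ∃ F} (X →-setoid ℕ) proj₁

-- Among any inhabited class of cardinals there is a least one.  Take
-- a maximal set of points of the product of all A i on which every
-- projection is injective (it is built as the top of a tower of such
-- sets): maximality makes the projection to some A i surjective, so
-- that A i embeds into every A j.

module LeastCardinal
  (ax : Classical) {Ix : Set₁} (A : Ix → Cardinal) (i₀ : Ix) where

  open Classical ax
  private
    module A i = Setoid (A i)

    Π : Set₁
    Π = ∀ i → A.Carrier i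

    𝒫 : Set₁
    𝒫 = Π → Bool

    infix 4 _∋_ _⊑_

    _∋_ : 𝒫 → Π → Set
    S ∋ x = T (S x)

    _⊑_ : 𝒫 → 𝒫 → Set₁
    S ⊑ S′ = ∀ x → S ∋ x → S′ ∋ x

    ⟦_⟧ : (Π → Set₁) → 𝒫
    ⟦ P ⟧ x = does (em {P = P x})

    ⟦⟧-intro : ∀ (P : Π → Set₁) {x} → P x → ⟦ P ⟧ ∋ x
    ⟦⟧-intro P {x} p with em {P = P x}
    ... | yes _ = tt
    ... | no ¬p = ¬p p

    ⟦⟧-elim : ∀ (P : Π → Set₁) {x} → ⟦ P ⟧ ∋ x → P x
    ⟦⟧-elim P {x} t with em {P = P x}
    ... | yes p = p

    T-ext : ∀ {a b} → (T a → T b) → (T b → T a) → a ≡ b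
    T-ext {true}  {true}  f g = refl
    T-ext {false} {false} f g = refl
    T-ext {true}  {false} f g = ⊥-elim (f tt)
    T-ext {false} {true}  f g = ⊥-elim (g tt)

    ⊑-antisym : ∀ {S S′} → S ⊑ S′ → S′ ⊑ S → S ≡ S′
    ⊑-antisym p q = ext λ x → T-ext (p x) (q x)

    Extendable : 𝒫 → Set₁
    Extendable S = ∀ i → Σ[ a ∈ A.Carrier i ] (∀ s → S ∋ s → ¬ A._≈_ i (s i) a)

    New : 𝒫 → Π → Set₁
    New S x with em {P = Extendable S}
    ... | yes e = x ≡ λ i → proj₁ (e i)
    ... | no _  = Level.Lift _ ⊥

    New-unique : ∀ S {x y} → New S x → New S y → x ≡ y
    New-unique S p q with em {P = Extendable S}
    ... | yes e = trans p (sym q)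
    New-unique S (Level.lift ()) q | no _

    New-fresh : ∀ S {x} → New S x → ∀ s → S ∋ s → ∀ i → ¬ A._≈_ i (s i) (x i)
    New-fresh S p s s∈ i with em {P = Extendable S}
    New-fresh S refl s s∈ i | yes e = proj₂ (e i) s s∈
    New-fresh S (Level.lift ()) s s∈ i | no _

    New-exists : ∀ S → Extendable S → ∃ (New S)
    New-exists S e with em {P = Extendable S}
    ... | yes e′ = _ , refl
    ... | no ¬e  = ⊥-elim (¬e e)

    Next : 𝒫 → Π → Set₁
    Next S x = S ∋ x ⊎ New S x

    _⁺ : 𝒫 → 𝒫
    S ⁺ = ⟦ Next S ⟧

    ⊑⁺ : ∀ S → S ⊑ S ⁺
    ⊑⁺ S x p = ⟦⟧-intro (Next S) (inj₁ p)

    InSome : (𝒫 → Bool) → Π → Set₁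
    InSome C x = Σ[ S ∈ 𝒫 ] T (C S) × S ∋ x

    sup : (𝒫 → Bool) → 𝒫
    sup C = ⟦ InSome C ⟧

    data Tower : 𝒫 → Set₁ where
      step : ∀ {S} → Tower S → Tower (S ⁺)
      lim  : ∀ C → (∀ S → T (C S) → Tower S) → Tower (sup C)

    sup-upper : ∀ C {S} → T (C S) → S ⊑ sup C
    sup-upper C {S} c x p = ⟦⟧-intro (InSome C) (S , c , p)

    Comparable : 𝒫 → Set₁
    Comparable S = ∀ {S′} → Tower S′ → S′ ⊑ S ⊎ S ⊑ S′

    below : ∀ {S S′} → S′ ⊑ S → S ⊑ S′ ⁺ → S ≡ S′ ⊎ S′ ⁺ ⊑ S
    below {S} {S′} p q with em {P = Σ[ x ∈ Π ] S ∋ x × New S′ x}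
    ... | yes (x , x∈ , n) = inj₂ λ y y∈ → case (⟦⟧-elim (Next S′) y∈)
      where
      case : ∀ {y} → S′ ∋ y ⊎ New S′ y → S ∋ y
      case (inj₁ r) = p _ r
      case (inj₂ n′) = subst (S ∋_) (New-unique S′ n n′) x∈
    ... | no ∄ = inj₁ (⊑-antisym (λ y y∈ → case y∈ (⟦⟧-elim (Next S′) (q y y∈))) p)
      where
      case : ∀ {y} → S ∋ y → S′ ∋ y ⊎ New S′ y → S′ ∋ y
      case _  (inj₁ r) = r
      case y∈ (inj₂ n) = ⊥-elim (∄ (_ , y∈ , n))

    gap : ∀ {S} → Comparable S → ∀ {S′} → Tower S′ → S′ ⊑ S ⊎ S ⁺ ⊑ S′
    gap {S} c (step {S′} t) with gap c t
    ... | inj₂ q = inj₂ λ x p → ⊑⁺ S′ x (q x p)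
    ... | inj₁ p with c (step t)
    ...   | inj₁ r = inj₁ r
    ...   | inj₂ r with below p r
    ...     | inj₁ refl = inj₂ λ x p → p
    ...     | inj₂ s    = inj₁ s
    gap {S} c (lim C h) with em {P = Σ[ S′ ∈ 𝒫 ] T (C S′) × S ⁺ ⊑ S′}
    ... | yes (S′ , c′ , q) = inj₂ λ x p → sup-upper C c′ x (q x p)
    ... | no ∄ = inj₁ λ x p → let S′ , c′ , r = ⟦⟧-elim (InSome C) p in case S′ c′ x r (gap c (h S′ c′))
      where
      case : ∀ S′ → T (C S′) → ∀ x → S′ ∋ x → S′ ⊑ S ⊎ S ⁺ ⊑ S′ → S ∋ x
      case S′ c′ x r (inj₁ q) = q x r
      case S′ c′ x r (inj₂ q) = ⊥-elim (∄ (S′ , c′ , q))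

    comparable : ∀ {S} → Tower S → Comparable S
    comparable (step {S} t) t′ with gap (comparable t) t′
    ... | inj₁ p = inj₁ λ x q → ⊑⁺ S x (p x q)
    ... | inj₂ p = inj₂ p
    comparable (lim C h) {S′} t′ with em {P = Σ[ S ∈ 𝒫 ] T (C S) × S′ ⊑ S}
    ... | yes (S , c , q) = inj₁ λ x p → sup-upper C c x (q x p)
    ... | no ∄ = inj₂ λ x p → let S , c , r = ⟦⟧-elim (InSome C) p in case S c x r (comparable (h S c) t′)
      where
      case : ∀ S → T (C S) → ∀ x → S ∋ x → S′ ⊑ S ⊎ S ⊑ S′ → S′ ∋ x
      case S c x r (inj₁ q) = ⊥-elim (∄ (S , c , q))
      case S c x r (inj₂ q) = q x r

    ProjInjective : 𝒫 → Set₁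
    ProjInjective S =
      ∀ s t → S ∋ s → S ∋ t → ∀ i → A._≈_ i (s i) (t i) → s ≡ t

    projInjective : ∀ {S} → Tower S → ProjInjective S
    projInjective (step {S} t) s u s∈ u∈ i eq = case (⟦⟧-elim (Next S) s∈) (⟦⟧-elim (Next S) u∈)
      where
      case : S ∋ s ⊎ New S s → S ∋ u ⊎ New S u → s ≡ u
      case (inj₁ p) (inj₁ q) = projInjective t s u p q i eq
      case (inj₁ p) (inj₂ q) = ⊥-elim (New-fresh S q s p i eq)
      case (inj₂ p) (inj₁ q) = ⊥-elim (New-fresh S p u q i (A.sym i eq))
      case (inj₂ p) (inj₂ q) = New-unique S p q
    projInjective (lim C h) s u s∈ u∈ i eq
      with ⟦⟧-elim (InSome C) s∈ | ⟦⟧-elim (InSome C) u∈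
    ... | S , c , p | S′ , c′ , q with comparable (h S c) (h S′ c′)
    ...   | inj₁ r = projInjective (h S c) s u p (r u q) i eq
    ...   | inj₂ r = projInjective (h S′ c′) s u (r s p) q i eq

    isTower : 𝒫 → Bool
    isTower S = does (em {P = Tower S})

    isTower-intro : ∀ {S} → Tower S → T (isTower S)
    isTower-intro {S} t with em {P = Tower S}
    ... | yes _ = tt
    ... | no ¬t = ¬t t

    isTower-elim : ∀ S → T (isTower S) → Tower S
    isTower-elim S p with em {P = Tower S}
    ... | yes t = t

    Top : 𝒫
    Top = sup isTower

    top : Tower Top
    top = lim isTower isTower-elim

    ¬extendable : ¬ Extendable Top
    ¬extendable e with New-exists Top e
    ... | x , n = New-fresh Top n x
      (sup-upper isTower (isTower-intro (step top)) x (⟦⟧-intro (Next Top) (inj₂ n)))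
      i₀ (A.refl i₀)

    Onto : Ix → Set₁
    Onto i = ∀ a → Σ[ s ∈ Π ] Top ∋ s × A._≈_ i (s i) a

    onto : ∃ Onto
    onto with em {P = ∃ Onto}
    ... | yes p = p
    ... | no ∄ = ⊥-elim (¬extendable missed)
      where
      missed : ∀ i → Σ[ a ∈ A.Carrier i ] (∀ s → Top ∋ s → ¬ A._≈_ i (s i) a)
      missed i with em {P = Σ[ a ∈ A.Carrier i ] (∀ s → Top ∋ s → ¬ A._≈_ i (s i) a)}
      ... | yes p = p
      ... | no ∄a = ⊥-elim (∄ (i , hit))
        where
        hit : Onto i
        hit a with em {P = Σ[ s ∈ Π ] Top ∋ s × A._≈_ i (s i) a}
        ... | yes p = p
        ... | no ∄s = ⊥-elim (∄a (a , λ s s∈ eq → ∄s (s , s∈ , eq)))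

  least : Σ[ i ∈ Ix ] (∀ j → A i ≤ᶜ A j)
  least = i , λ j → record
    { to        = λ a → pick a j
    ; cong      = λ {a} {b} a≈b → A.reflexive j (cong (λ s → s j)
        (projInjective top (pick a) (pick b) (pick∈ a) (pick∈ b) i
          (A.trans i (pick≈ a) (A.trans i a≈b (A.sym i (pick≈ b))))))
    ; injective = λ {a} {b} eq → A.trans i (A.sym i (pick≈ a))
        (A.trans i (A.reflexive i (cong (λ s → s i)
          (projInjective top (pick a) (pick b) (pick∈ a) (pick∈ b) j eq)))
          (pick≈ b))
    }
    where
    i = proj₁ onto
    pick : A.Carrier i → Π
    pick a = proj₁ (proj₂ onto a)
    pick∈ : ∀ a → Top ∋ pick a
    pick∈ a = proj₁ (proj₂ (proj₂ onto a))
    pick≈ : ∀ a → A._≈_ i (pick a i) a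
    pick≈ a = proj₂ (proj₂ (proj₂ onto a))

IsLeastCardOf : {X : Set} → (Pred (X → ℕ) 0ℓ → Set) → Cardinal → Set₁
IsLeastCardOf P κ =
  (∃[ F ] P F × κ ≡ card F) × (∀ F → P F → κ ≤ᶜ card F)

leastCard : Classical → {X : Set} (P : Pred (X → ℕ) 0ℓ → Set) →
            ∃ P → ∃ (IsLeastCardOf P)
leastCard ax P F₀ with LeastCardinal.least ax (λ (F : ∃ P) → card (proj₁ F)) F₀
... | (F , pF) , min = card F , (F , pF , refl) , λ G pG → min (G , pG)

_≤[_]_ : {X : Set} → (X → ℕ) → Ideal X → (X → ℕ) → Set
f ≤[ I ] g = Mem I (λ x → g x <ᵇ f x)

𝒟 : {X : Set} → Ideal X → Pred (X → ℕ) 0ℓ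
𝒟 I f = ∀ n → Mem I (λ x → f x ≡ᵇ n)

Unbounded : {X : Set} → Ideal X → Pred (X → ℕ) 0ℓ → Set
Unbounded I F =
  F ⊆ 𝒟 I × ¬ (∃[ g ] g ∈ 𝒟 I × (∀ f → F f → g ≤[ I ] f))

Dominating : Pred (ℕ → ℕ) 0ℓ → Set
Dominating F =
  ∀ (g : ℕ → ℕ) → ∃[ f ] F f × (∃[ m ] (∀ n → m ≤ n → g n ≤ f n))

𝒟-unbounded : {X : Set} (I : Ideal X) → Unbounded I (𝒟 I)
𝒟-unbounded {X} I = (λ {f} f∈ → f∈) , λ (g , g∈ , low) →
  I.proper (I.⊆-closed (λ x _ → cover (g x))
    (I.∪-closed (g∈ 0) (low (pred ∘ g) (pred∈ g g∈))))
  where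
  module I = Ideal I

  cover : ∀ k → T ((k ≡ᵇ 0) ∨ (pred k <ᵇ k))
  cover zero    = tt
  cover (suc k) = <⇒<ᵇ (n<1+n k)

  shift : ∀ k n → T (pred k ≡ᵇ n) → T ((k ≡ᵇ 0) ∨ (k ≡ᵇ suc n))
  shift zero    n _ = tt
  shift (suc k) n p = p

  pred∈ : ∀ g → 𝒟 I g → 𝒟 I (pred ∘ g)
  pred∈ g g∈ n =
    I.⊆-closed (λ x → shift (g x) n) (I.∪-closed (g∈ 0) (g∈ (suc n)))

U-dominating : Dominating U
U-dominating g = g , tt , 0 , λ n _ → ≤-refl

𝔟 : Classical → {X : Set} → Ideal X → Cardinal
𝔟 ax I = proj₁ (leastCard ax (Unbounded I) (𝒟 I , 𝒟-unbounded I))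

𝔟-isLeast : (ax : Classical) {X : Set} (I : Ideal X) →
            IsLeastCardOf (Unbounded I) (𝔟 ax I)
𝔟-isLeast ax I = proj₂ (leastCard ax (Unbounded I) (𝒟 I , 𝒟-unbounded I))

𝔡 : Classical → Cardinal
𝔡 ax = proj₁ (leastCard ax Dominating (U , U-dominating))

𝔡-isLeast : (ax : Classical) → IsLeastCardOf Dominating (𝔡 ax)
𝔡-isLeast ax = proj₂ (leastCard ax Dominating (U , U-dominating))

{-# OPTIONS --safe #-}
-- Suppose 𝔟(I) ≰ 𝔡, so that every family of functions in 𝒟 I indexed by a
-- dominating family has a lower bound in 𝒟 I.  Let Z be the space of all
-- sequences z of codes for clopen subsets of Z, and let
-- eval z = {x : z ∈ ⟦ z x ⟧}.  By induction, every Borel B ⊆ Z is the I-limit of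
-- a sequence U of clopen sets: if U i is such a sequence for P i, then
-- x ↦ ⋃_{i < g x} U i x is one for ⋃ P i, where g ∈ 𝒟 I grows slowly enough.
-- To find g with few test functions, the convergence at the points of Z is
-- controlled by members of I indexed by ω^ω, and it is enough to
-- look at a cofinal set of indices.  If S is Borel and separates I from its
-- dual, then U for B = eval⁻¹[S], viewed as a point of Z, is in B if and only if
-- it is not.  Analytic ideals are Borel-separated by Lusin's theorem.
module Submission where

open import Defs
open import Level using (0ℓ)
open import Data.Bool using (Bool; true; false; not; _∨_; T)
open import Data.Bool.Properties using (T-∨; not-involutive)
open import Data.Empty using (⊥; ⊥-elim)
open import Data.List using (List; []; _∷_; _++_; map; cartesianProductWith)
open import Data.List.Extrema.Nat using (max; xs≤max)
open import Data.List.Membership.Propositional using () renaming (_∈_ to _∈ˡ_)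
open import Data.List.Membership.Propositional.Properties
  using (∈-++⁺ˡ; ∈-++⁺ʳ; ∈-map⁺; ∈-cartesianProductWith⁺)
open import Data.List.Relation.Unary.All using (All; []; _∷_)
import Data.List.Relation.Unary.All as All
open import Data.List.Relation.Unary.All.Properties using (++⁻ˡ; ++⁻ʳ)
open import Data.List.Relation.Unary.Any using (here; there)
open import Data.Nat
  using (ℕ; zero; suc; _+_; _⊔_; _≤_; _<_; s≤s; s<s⁻¹; _≡ᵇ_; _<ᵇ_; _<?_; _≤′_; ≤′-reflexive; ≤′-step)
open import Data.Nat.Properties
open import Data.Product using (Σ-syntax; ∃-syntax; _×_; _,_; proj₁; proj₂)
open import Data.Sum using (_⊎_; inj₁; inj₂; [_,_]′)
import Data.Sum as Sum
open import Data.Unit using (tt)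
open import Function using (_∘_; id)
open import Function.Bundles using (_↣_; _⇔_; mk⇔; module Injection; module Equivalence)
open import Function.Construct.Composition using (injection)
open import Function.Construct.Identity using (↣-id)
open import Relation.Binary.PropositionalEquality
  using (_≡_; refl; sym; trans; cong; subst; _≗_)
open import Relation.Nullary using (¬_; yes; no; does)
open import Relation.Nullary.Decidable using (decidable-stable; recompute)
open import Relation.Unary using (Pred; ∁; _⊆_; _≐_; _∩_; ⋃; Empty)

open Equivalence using (to; from)

-- Preimages of Borel sets and separation by Borel sets.

preimage-Borel : {X D Y E : Set} {φ : (X → D) → (Y → E)} → Continuous φ →
                 ∀ {P} → Borel P → Borel (λ a → P (φ a))
preimage-Borel c (isOpen o)       = isOpen (c _ o)
preimage-Borel c (compl b)        = compl (preimage-Borel c b)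
preimage-Borel c (union b)        = union (λ n → preimage-Borel c (b n))
preimage-Borel c (resp (l , r) b) = resp ((λ p → l p) , (λ p → r p)) (preimage-Borel c b)

Separated : {X : Set} (A C : Pred (Subset X) 0ℓ) → Set₁
Separated A C = Σ[ S ∈ Pred (Subset _) 0ℓ ] Borel S × A ⊆ S × Empty (C ∩ S)

∉-∪ : {X : Set} (A B : Subset X) {x : X} → ¬ T (A x ∨ B x) → ¬ T (A x) × ¬ T (B x)
∉-∪ A B {x} x∉ = (λ a → x∉ (from (T-∨ {A x}) (inj₁ a))) , (λ b → x∉ (from (T-∨ {A x}) (inj₂ b)))

module Classically (ax : Classical) where
  open Classical ax

  ¬¬-elim : ∀ {ℓ} {A : Set ℓ} → ¬ ¬ A → A
  ¬¬-elim = decidable-stable em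

  ¬∀⇒∃¬ : ∀ {a b} {A : Set a} {P : A → Set b} → ¬ (∀ x → P x) → ∃[ x ] ¬ P x
  ¬∀⇒∃¬ ¬∀ = ¬¬-elim λ ∄ → ¬∀ λ x → ¬¬-elim λ ¬p → ∄ (x , ¬p)

  ⟪_⟫ : {X : Set} → Pred X 0ℓ → Subset X
  ⟪ P ⟫ x = does (em {P = P x})

  T-⟪⟫ : {X : Set} (P : Pred X 0ℓ) {x : X} → T (⟪ P ⟫ x) ⇔ P x
  T-⟪⟫ P {x} with em {P = P x}
  ... | yes p = mk⇔ (λ _ → p) (λ _ → tt)
  ... | no ¬p = mk⇔ (λ ()) ¬p

  ⟪⟫-cong : {X : Set} (P Q : Pred X 0ℓ) {x y : X} → P x ⇔ Q y → ⟪ P ⟫ x ≡ ⟪ Q ⟫ y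
  ⟪⟫-cong P Q {x} {y} e with em {P = P x} | em {P = Q y}
  ... | yes _ | yes _ = refl
  ... | no _  | no _  = refl
  ... | yes p | no ¬q = ⊥-elim (¬q (to e p))
  ... | no ¬p | yes q = ⊥-elim (¬p (from e q))

  -- Lusin separation

  module _ {X : Set} where

    -- For fixed i, the intersection over j of the given separators contains `A i` and misses every
    -- `C j`; these sets are then united over i. The complements express the intersections.
    sep-⋃ : {A C : ℕ → Pred (Subset X) 0ℓ} →
            (∀ i j → Separated (A i) (C j)) → Separated (⋃ ℕ A) (⋃ ℕ C)
    sep-⋃ s =
      ⋃ ℕ (λ i → ∁ (⋃ ℕ λ j → ∁ (proj₁ (s i j)))) ,
      union (λ i → compl (union λ j → compl (proj₁ (proj₂ (s i j))))) ,
      (λ (i , a) → i , λ (j , ¬s) → ¬s (proj₁ (proj₂ (proj₂ (s i j))) a)) ,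
      λ B → λ ((j , c) , (i , ¬∃)) → ¬∃ (j , λ s∈ → proj₂ (proj₂ (proj₂ (s i j))) B (c , s∈))

    sep-⊆ : {A A′ C C′ : Pred (Subset X) 0ℓ} → A ⊆ A′ → C ⊆ C′ →
            Separated A′ C′ → Separated A C
    sep-⊆ p q (S , b , s , e) = S , b , (λ a → s (p a)) , λ B (c , t) → e B (q c , t)

    Agree : (ℕ → ℕ) → ℕ → Pred (ℕ → ℕ) 0ℓ
    Agree a n β = ∀ i → i < n → β i ≡ a i

    Image : ((ℕ → ℕ) → Subset X) → (ℕ → ℕ) → ℕ → Pred (Subset X) 0ℓ
    Image φ a n A = ∃[ β ] Agree a n β × φ β ≗ A

    _[_≔_] : (ℕ → ℕ) → ℕ → ℕ → ℕ → ℕ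
    (a [ n ≔ v ]) i with i ≟ n
    ... | yes _ = v
    ... | no _  = a i

    ≔-old : ∀ a n v i → i < n → (a [ n ≔ v ]) i ≡ a i
    ≔-old a n v i i<n with i ≟ n
    ... | yes refl = ⊥-elim (<-irrefl refl i<n)
    ... | no _     = refl

    Agree-≔ : ∀ a n β → Agree a n β → Agree (a [ n ≔ β n ]) (suc n) β
    Agree-≔ a n β ag i i<sn with i ≟ n
    ... | yes refl = refl
    ... | no i≢n   = ag i (≤∧≢⇒< (m<1+n⇒m≤n i<sn) i≢n)

    Image-split : ∀ φ a n → Image φ a n ⊆ ⋃ ℕ (λ v → Image φ (a [ n ≔ v ]) (suc n))
    Image-split φ a n (β , ag , eq) = β n , β , Agree-≔ a n β ag , eq

    module _ (φ ψ : (ℕ → ℕ) → Subset X) where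

      Inseparable : ℕ → Set₁
      Inseparable n = Σ[ a ∈ (ℕ → ℕ) ] Σ[ b ∈ (ℕ → ℕ) ] ¬ Separated (Image φ a n) (Image ψ b n)

      -- If all pairs of one-step extensions had separable images, `sep-⋃` would separate the images
      -- at stage n.
      refine : ∀ {n} ((a , b , _) : Inseparable n) →
               Σ[ (a′ , b′ , _) ∈ Inseparable (suc n) ] Agree a n a′ × Agree b n b′
      refine {n} (a , b , ¬s) 
        with ¬∀⇒∃¬ {P = λ (i , j) → Separated (Image φ (a [ n ≔ i ]) (suc n)) (Image ψ (b [ n ≔ j ]) (suc n))}
               (λ all → ¬s (sep-⊆ (Image-split φ a n) (Image-split ψ b n) (sep-⋃ λ i j → all (i , j))))
      ... | (i , j) , ¬s′ = (a [ n ≔ i ] , b [ n ≔ j ] , ¬s′) , ≔-old a n i , ≔-old b n j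

      branch : ¬ Separated (Image φ id 0) (Image ψ id 0) → ∀ n → Inseparable n
      branch ¬s zero    = id , id , ¬s
      branch ¬s (suc n) = proj₁ (refine (branch ¬s n))

    -- For a coherent sequence of stages, entry n is final from stage n + 1 on.
    limit : (ℕ → ℕ → ℕ) → ℕ → ℕ
    limit a n = a (suc n) n

    limit-agree : ∀ a → (∀ n → Agree (a n) n (a (suc n))) → ∀ n → Agree (a n) n (limit a)
    limit-agree a coh (suc n) i i<sn with m≤n⇒m<n∨m≡n (m<1+n⇒m≤n i<sn)
    ... | inj₁ i<n  = trans (limit-agree a coh n i i<n) (sym (coh n i i<n))
    ... | inj₂ refl = refl

    value-isOpen : ∀ x v → IsOpen {X} {Bool} (λ A → A x ≡ v)
    value-isOpen x v A eq = (x ∷ []) , λ { B (p ∷ []) → trans p eq }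

    modulus : ∀ {φ : (ℕ → ℕ) → Subset X} → Continuous φ → ∀ α x →
              ∃[ m ] (∀ n → m ≤ n → ∀ β → Agree α n β → φ β x ≡ φ α x)
    modulus {φ} c α x with c (λ A → A x ≡ φ α x) (value-isOpen x _) α refl
    -- `Agree` is strict in its bound, so the successor makes it cover the largest coordinate too.
    ... | is , near = suc (max 0 is) , λ n m≤n β ag →
      near β (All.map (λ {i} i≤ → ag i (≤-trans (s≤s i≤) m≤n)) (xs≤max 0 is))

    lusin : ∀ {φ ψ : (ℕ → ℕ) → Subset X} → Continuous φ → Continuous ψ →
            (∀ α β → ¬ (φ α ≗ ψ β)) →
            Separated (λ A → ∃[ α ] φ α ≗ A) (λ A → ∃[ β ] ψ β ≗ A)
    lusin {φ} {ψ} cφ cψ disj = ¬¬-elim λ ¬s → contradiction λ s → ¬s (sep-⊆ whole whole s)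
      where
      whole : ∀ {χ : (ℕ → ℕ) → Subset X} {A} → ∃[ α ] χ α ≗ A → Image χ id 0 A
      whole (α , eq) = α , (λ _ ()) , eq

      module _ (¬s : ¬ Separated (Image φ id 0) (Image ψ id 0)) where
        a b : ℕ → ℕ → ℕ
        a n = proj₁ (branch φ ψ ¬s n)
        b n = proj₁ (proj₂ (branch φ ψ ¬s n))

        a-coherent : ∀ n → Agree (a n) n (a (suc n))
        a-coherent n = proj₁ (proj₂ (refine φ ψ (branch φ ψ ¬s n)))

        b-coherent : ∀ n → Agree (b n) n (b (suc n))
        b-coherent n = proj₂ (proj₂ (refine φ ψ (branch φ ψ ¬s n)))

        contradiction : ⊥
        contradiction
          with ¬∀⇒∃¬ (disj (limit a) (limit b))
        ... | x , φx≢ψx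
          with modulus cφ (limit a) x | modulus cψ (limit b) x
        ... | m , nearφ | k , nearψ =
          -- By continuity each image at stage n has a constant bit at x, and the two bits differ,
          -- so a clopen set separates a pair chosen to be inseparable.
          proj₂ (proj₂ (branch φ ψ ¬s n))
            ( (λ A → A x ≡ φ (limit a) x) , isOpen (value-isOpen x _)
            , value a-coherent (nearφ n (m≤m⊔n m k))
            , λ A (C∋A , S∋A) →
                φx≢ψx (trans (sym S∋A) (value b-coherent (nearψ n (m≤n⊔m m k)) C∋A)))
          where
          n = m ⊔ k
          value : ∀ {χ : (ℕ → ℕ) → Subset X} {c} → (∀ n → Agree (c n) n (c (suc n))) →
                  (∀ β → Agree (limit c) n β → χ β x ≡ χ (limit c) x) →
                  ∀ {A} → Image χ (c n) n A → A x ≡ χ (limit c) x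
          value {c = c} coh near (β , ag , eq) = trans (sym (eq x))
            (near β λ i i<n → trans (ag i i<n) (sym (limit-agree c coh n i i<n)))

  -- Families of functions in 𝒟 I when 𝔟(I) ≰ 𝔡

  image : {X : Set} → ((ℕ → ℕ) → X → ℕ) → Pred (ℕ → ℕ) 0ℓ → Pred (X → ℕ) 0ℓ
  image Ψ D φ = ∃[ f ] D f × φ ≗ Ψ f

  card-image : {X : Set} (Ψ : (ℕ → ℕ) → X → ℕ) (D : Pred (ℕ → ℕ) 0ℓ) →
               card (image Ψ D) ≤ᶜ card D
  card-image Ψ D = record
    { to        = λ (φ , p) → let f , d , _ = pick φ p in f , d
    ; cong      = λ {x} {y} eq n → cong-app′ (pick-cong (proj₂ x) (proj₂ y) (ext eq)) n
    ; injective = λ {x} {y} eq n → trans (proj₂ (proj₂ (pick _ (proj₂ x))) n)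
        (trans (cong (λ f → Ψ f n) (ext eq)) (sym (proj₂ (proj₂ (pick _ (proj₂ y))) n)))
    }
    where
    -- With the membership proof irrelevant, the chosen preimage depends on φ alone, as `cong`
    -- requires: `card` ignores these proofs.
    pick : ∀ φ → .(image Ψ D φ) → image Ψ D φ
    pick φ p = recompute em p

    pick-cong : ∀ {φ φ′} (p : image Ψ D φ) (p′ : image Ψ D φ′) → φ ≡ φ′ →
                proj₁ (pick φ p) ≡ proj₁ (pick φ′ p′)
    pick-cong p p′ refl = refl

    cong-app′ : ∀ {f g : ℕ → ℕ} → f ≡ g → f ≗ g
    cong-app′ refl _ = refl

  module _ {X : Set} (ι : X ↣ ℕ) (I : Ideal X) where
    open module ι = Injection ι using () renaming (to to index)
    private module I = Ideal I

    fibre : ∀ k → Σ[ xs ∈ List X ] (∀ x → index x ≡ k → x ∈ˡ xs)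
    fibre k with em {P = ∃[ x ] index x ≡ k}
    ... | yes (x , eq) = (x ∷ []) , λ y eq′ → here (ι.injective (trans eq′ (sym eq)))
    ... | no ∄         = [] , λ y eq → ⊥-elim (∄ (y , eq))

    fibre∈ : ∀ k → Mem I (λ x → index x ≡ᵇ k)
    fibre∈ k = I.finite (proj₁ (fibre k)) λ x t → proj₂ (fibre k) x (≡ᵇ⇒≡ _ _ t)

    ⋃< : (ℕ → Subset X) → ℕ → Subset X
    ⋃< N zero    x = false
    ⋃< N (suc k) x = N k x ∨ ⋃< N k x

    ⋃<-∈ : ∀ {N} → (∀ i → Mem I (N i)) → ∀ k → Mem I (⋃< N k)
    ⋃<-∈ N∈ zero    = I.finite [] λ _ ()
    ⋃<-∈ N∈ (suc k) = I.∪-closed (N∈ k) (⋃<-∈ N∈ k)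

    ⋃<-intro : ∀ N {i k x} → i < k → T (N i x) → T (⋃< N k x)
    ⋃<-intro N {k = suc k} i<sk t with m≤n⇒m<n∨m≡n (m<1+n⇒m≤n i<sk)
    ... | inj₁ i<k  = from T-∨ (inj₂ (⋃<-intro N i<k t))
    ... | inj₂ refl = from T-∨ (inj₁ t)

    below : (X → ℕ) → ℕ → Subset X
    below g = ⋃< (λ n x → g x ≡ᵇ n)

    below-∉ : ∀ g k {x} → ¬ T (below g k x) → k ≤ g x
    below-∉ g k {x} ∉ = ≮⇒≥ λ g<k → ∉ (⋃<-intro (λ n x → g x ≡ᵇ n) g<k (≡⇒≡ᵇ (g x) _ refl))

    first : (ℕ → Bool) → ℕ → ℕ
    first p zero    = zero
    first p (suc b) with p 0
    ... | true  = zero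
    ... | false = suc (first (p ∘ suc) b)

    first-minimal : ∀ p b i → i < first p b → ¬ T (p i)
    first-minimal p (suc b) i i< t with p 0 in eq
    first-minimal p (suc b) zero    i< t | false = subst T eq t
    first-minimal p (suc b) (suc i) i< t | false = first-minimal (p ∘ suc) b i (s<s⁻¹ i<) t

    first-attained : ∀ p b → T (p (first p b)) ⊎ b ≡ first p b
    first-attained p zero = inj₂ refl
    first-attained p (suc b) with p 0 in eq
    ... | true  = inj₁ (subst T (sym eq) tt)
    ... | false = Sum.map id (cong suc) (first-attained (p ∘ suc) b)

    -- The cutoff at `index x` makes the search total and adds at most one point to each level set,
    -- `index` being injective. A value above i still certifies that x lies outside `N i`.
    diagonal : (ℕ → Subset X) → X → ℕ
    diagonal N x = first (λ k → N k x) (index x)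

    diagonal∈𝒟 : ∀ {N} → (∀ k → Mem I (N k)) → 𝒟 I (diagonal N)
    diagonal∈𝒟 {N} N∈ k = I.⊆-closed (λ x t → from T-∨ (level x (≡ᵇ⇒≡ _ k t)))
      (I.∪-closed (N∈ k) (fibre∈ k))
      where
      level : ∀ x → diagonal N x ≡ k → T (N k x) ⊎ T (index x ≡ᵇ k)
      level x refl = Sum.map₂ (≡⇒≡ᵇ (index x) _) (first-attained (λ k → N k x) (index x))

    module _ (𝔟≰𝔡 : ¬ (𝔟 ax I ≤ᶜ 𝔡 ax)) where

      -- Without such a g the functions `Ψ f` with f in D would form an unbounded family, so 𝔟(I)
      -- would be at most the cardinality of D, which is 𝔡.
      lower-bound : (D : Pred (ℕ → ℕ) 0ℓ) → 𝔡 ax ≡ card D →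
                    (Ψ : (ℕ → ℕ) → X → ℕ) → (∀ f → 𝒟 I (Ψ f)) →
                    Σ[ g ∈ (X → ℕ) ] 𝒟 I g × (∀ f → D f → g ≤[ I ] Ψ f)
      lower-bound D 𝔡≡ Ψ Ψ∈ = ¬¬-elim λ ∄ → 𝔟≰𝔡
        (subst (𝔟 ax I ≤ᶜ_) (sym 𝔡≡)
          (injection
            (proj₂ (𝔟-isLeast ax I) (image Ψ D)
              ( (λ (f , _ , eq) → subst (𝒟 I) (sym (ext eq)) (Ψ∈ f))
              , λ (g , g∈ , low) → ∄ (g , g∈ , λ f d → low (Ψ f) (f , d , λ _ → refl))))
            (card-image Ψ D)))

      -- A dominating family dominates only modulo finite sets.  Instead of
      -- closing it under finite modifications, the shifts f + m of f for all m
      -- are diagonalised into the one function Ψ f.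
      slow-function : (N : (ℕ → ℕ) → ℕ → Subset X) → (∀ f i → Mem I (N f i)) →
        Σ[ g ∈ (X → ℕ) ] 𝒟 I g × (∀ h → Σ[ f ∈ (ℕ → ℕ) ] (∀ n → h n ≤ f n) ×
          Σ[ M ∈ Subset X ] Mem I M × (∀ x → ¬ T (M x) → ∀ i → i < g x → ¬ T (N f i x)))
      slow-function N N∈ = g , g∈ , λ h → cofinal h (dom h)
        where
        -- Level k handles all shifts m and indices i up to k at once, and is still in I as a finite
        -- union.
        N′ : (ℕ → ℕ) → ℕ → Subset X
        N′ f k = ⋃< (λ m → ⋃< (N (λ n → m + f n)) (suc k)) (suc k)

        Ψ : (ℕ → ℕ) → X → ℕ
        Ψ f = diagonal (N′ f)

        Ψ∈ : ∀ f → 𝒟 I (Ψ f)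
        Ψ∈ f = diagonal∈𝒟 {N′ f} λ k → ⋃<-∈ (λ m → ⋃<-∈ (N∈ _) (suc k)) (suc k)

        D : Pred (ℕ → ℕ) 0ℓ
        D = proj₁ (proj₁ (𝔡-isLeast ax))

        dom : Dominating D
        dom = proj₁ (proj₂ (proj₁ (𝔡-isLeast ax)))

        bounded : Σ[ g ∈ (X → ℕ) ] 𝒟 I g × (∀ f → D f → g ≤[ I ] Ψ f)
        bounded = lower-bound D (proj₂ (proj₂ (proj₁ (𝔡-isLeast ax)))) Ψ Ψ∈

        g : X → ℕ
        g = proj₁ bounded

        g∈ : 𝒟 I g
        g∈ = proj₁ (proj₂ bounded)

        cofinal : ∀ h → ∃[ f ] D f × (∃[ m ] (∀ n → m ≤ n → h n ≤ f n)) →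
          Σ[ f ∈ (ℕ → ℕ) ] (∀ n → h n ≤ f n) ×
          Σ[ M ∈ Subset X ] Mem I M × (∀ x → ¬ T (M x) → ∀ i → i < g x → ¬ T (N f i x))
        cofinal h (f , d , m , h≤*f) =
          -- s bounds h below m, where f need not dominate it.
          (λ n → s + f n) , h≤ ,
          -- Off this set `s < g x ≤ Ψ f x`. If also `i < g x`, then x avoids level `i ⊔ s` of
          -- `N′ f`, which includes the set for shift s and index i.
          (λ x → (Ψ f x <ᵇ g x) ∨ below g (suc s) x) ,
          I.∪-closed (proj₂ (proj₂ bounded) f d) (⋃<-∈ g∈ (suc s)) ,
          λ x x∉ i i<g x∈ →
            let x∉₁ , x∉₂ = ∉-∪ (λ x → Ψ f x <ᵇ g x) (below g (suc s)) x∉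
                i⊔s<Ψ = <-≤-trans (⊔-lub i<g (below-∉ g (suc s) x∉₂))
                          (≮⇒≥ λ Ψ<g → x∉₁ (<⇒<ᵇ Ψ<g))
            in first-minimal (λ k → N′ f k x) (index x) (i ⊔ s) i⊔s<Ψ
                 (⋃<-intro _ (s≤s (m≤n⊔m i s)) (⋃<-intro (N _) (s≤s (m≤m⊔n i s)) x∈))
          where
          initial-bound : ∀ m → ∃[ s ] (∀ n → n < m → h n ≤ s)
          initial-bound zero = 0 , λ _ ()
          initial-bound (suc m) = let s , h≤s = initial-bound m in
            h m ⊔ s , λ n n<sm → [ (λ n<m → ≤-trans (h≤s n n<m) (m≤n⊔m (h m) s))
                                 , (λ { refl → m≤m⊔n (h m) s }) ]′
                                 (m≤n⇒m<n∨m≡n (m<1+n⇒m≤n n<sm))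

          s : ℕ
          s = proj₁ (initial-bound m)

          h≤ : ∀ n → h n ≤ s + f n
          h≤ n with n <? m
          ... | yes n<m = ≤-trans (proj₂ (initial-bound m) n n<m) (m≤m+n s (f n))
          ... | no n≮m  = ≤-trans (h≤*f n (≮⇒≥ n≮m)) (m≤n+m (f n) s)

    -- Clopen codes

    -- `at x c` compares the entry `z x` with c as syntax, without evaluating it; so `⟦_⟧` is
    -- structurally recursive although the points are themselves sequences of codes.
    data Code : Set where
      none : Code
      comp : Code → Code
      _∪ᶜ_ : Code → Code → Code
      at   : X → Code → Code

    ⟦_⟧ : Code → Pred (X → Code) 0ℓ
    ⟦ none ⟧ z   = ⊥
    ⟦ comp c ⟧ z = ¬ ⟦ c ⟧ z
    ⟦ c ∪ᶜ d ⟧ z = ⟦ c ⟧ z ⊎ ⟦ d ⟧ z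
    ⟦ at x c ⟧ z = z x ≡ c

    support : Code → List X
    support none     = []
    support (comp c) = support c
    support (c ∪ᶜ d) = support c ++ support d
    support (at x c) = x ∷ []

    support-determines : ∀ c {z z′} → All (λ x → z′ x ≡ z x) (support c) → ⟦ c ⟧ z′ ⇔ ⟦ c ⟧ z
    support-determines none _ = mk⇔ id id
    support-determines (comp c) eq =
      let e = support-determines c eq in mk⇔ (_∘ from e) (_∘ to e)
    support-determines (c ∪ᶜ d) eq =
      let e = support-determines c (++⁻ˡ _ eq)
          f = support-determines d (++⁻ʳ (support c) eq)
      in mk⇔ (Sum.map (to e) (to f)) (Sum.map (from e) (from f))
    support-determines (at x c) (eq ∷ []) = mk⇔ (trans (sym eq)) (trans eq)

    eval : (X → Code) → Subset X
    eval z = ⟪ (λ x → ⟦ z x ⟧ z) ⟫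

    eval-continuous : Continuous eval
    eval-continuous P o z p with o (eval z) p
    ... | xs , near = supports xs , λ z′ eq → near (eval z′) (agree xs eq)
      where
      -- The bit of `eval z` at x is determined by the code `z x` together with the entries of z on
      -- the support of that code.
      supports : List X → List X
      supports []       = []
      supports (x ∷ xs) = x ∷ (support (z x) ++ supports xs)

      agree : ∀ xs {z′} → All (λ x → z′ x ≡ z x) (supports xs) →
              All (λ x → eval z′ x ≡ eval z x) xs
      agree [] _ = []
      agree (x ∷ xs) {z′} (eq ∷ eqs) =
        ⟪⟫-cong (λ x → ⟦ z′ x ⟧ z′) (λ x → ⟦ z x ⟧ z)
          (subst (λ c → ⟦ c ⟧ z′ ⇔ ⟦ z x ⟧ z) (sym eq) (support-determines (z x) (++⁻ˡ _ eqs)))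
        ∷ agree xs (++⁻ʳ (support (z x)) eqs)

    -- The complement of a basic neighbourhood of z: codes have unions but no intersections, so the
    -- neighbourhood itself is `comp (away z xs)`.
    away : (X → Code) → List X → Code
    away z []       = none
    away z (x ∷ xs) = comp (at x (z x)) ∪ᶜ away z xs

    away-self : ∀ z xs → ¬ ⟦ away z xs ⟧ z
    away-self z (x ∷ xs) (inj₁ z≢z) = z≢z refl
    away-self z (x ∷ xs) (inj₂ a)   = away-self z xs a

    ¬away : ∀ z xs {z′} → ¬ ⟦ away z xs ⟧ z′ → All (λ x → z′ x ≡ z x) xs
    ¬away z []       _  = []
    ¬away z (x ∷ xs) ¬a = ¬¬-elim (¬a ∘ inj₁) ∷ ¬away z xs (¬a ∘ inj₂)

    -- Enumeration of points and codes by increasing finite lists.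

    stage-mono : {A : Set} (L : ℕ → List A) → (∀ k {a} → a ∈ˡ L k → a ∈ˡ L (suc k)) →
                 ∀ {k l a} → k ≤ l → a ∈ˡ L k → a ∈ˡ L l
    stage-mono L incl k≤l a∈ = go (≤⇒≤′ k≤l)
      where
      go : ∀ {l} → _ ≤′ l → _ ∈ˡ L l
      go (≤′-reflexive refl) = a∈
      go (≤′-step k≤′l)      = incl _ (go k≤′l)

    points : ℕ → List X
    points zero    = []
    points (suc k) = points k ++ proj₁ (fibre k)

    codes : ℕ → List Code
    codes zero    = none ∷ []
    codes (suc k) = codes k ++ map comp (codes k)
      ++ cartesianProductWith _∪ᶜ_ (codes k) (codes k)
      ++ cartesianProductWith at (points k) (codes k)

    points-mono : ∀ {k l x} → k ≤ l → x ∈ˡ points k → x ∈ˡ points l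
    points-mono = stage-mono points λ _ → ∈-++⁺ˡ

    codes-mono : ∀ {k l c} → k ≤ l → c ∈ˡ codes k → c ∈ˡ codes l
    codes-mono = stage-mono codes λ _ → ∈-++⁺ˡ

    codes-complete : ∀ c → ∃[ k ] c ∈ˡ codes k
    codes-complete none = 0 , here refl
    codes-complete (comp c) = let k , c∈ = codes-complete c in
      suc k , ∈-++⁺ʳ (codes k) (∈-++⁺ˡ (∈-map⁺ comp c∈))
    codes-complete (c ∪ᶜ d) =
      let k , c∈ = codes-complete c
          l , d∈ = codes-complete d
          m      = k ⊔ l
      in suc m , ∈-++⁺ʳ (codes m) (∈-++⁺ʳ (map comp (codes m)) (∈-++⁺ˡ
           (∈-cartesianProductWith⁺ _∪ᶜ_ (codes-mono (m≤m⊔n k l) c∈) (codes-mono (m≤n⊔m k l) d∈))))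
    codes-complete (at x c) =
      let k , c∈ = codes-complete c
          -- `points l` lists the points of index below l, hence the successor.
          l      = suc (index x)
          m      = k ⊔ l
          x∈     = ∈-++⁺ʳ (points (index x)) (proj₂ (fibre (index x)) x refl)
      in suc m , ∈-++⁺ʳ (codes m) (∈-++⁺ʳ (map comp (codes m))
           (∈-++⁺ʳ (cartesianProductWith _∪ᶜ_ (codes m) (codes m))
             (∈-cartesianProductWith⁺ at (points-mono (m≤n⊔m k l) x∈) (codes-mono (m≤m⊔n k l) c∈))))

    -- Open sets as countable unions of clopen sets.

    module _ (P : Pred (X → Code) 0ℓ) where

      inside : List Code → Code
      inside [] = none
      inside (c ∷ cs) with em {P = ⟦ c ⟧ ⊆ P}
      ... | yes _ = c ∪ᶜ inside cs
      ... | no _  = inside cs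

      inside-⊆ : ∀ cs → ⟦ inside cs ⟧ ⊆ P
      inside-⊆ (c ∷ cs) p with em {P = ⟦ c ⟧ ⊆ P}
      inside-⊆ (c ∷ cs) (inj₁ p) | yes c⊆P = c⊆P p
      inside-⊆ (c ∷ cs) (inj₂ p) | yes _   = inside-⊆ cs p
      inside-⊆ (c ∷ cs) p        | no _    = inside-⊆ cs p

      inside-⊇ : ∀ cs {c} → c ∈ˡ cs → ⟦ c ⟧ ⊆ P → ⟦ c ⟧ ⊆ ⟦ inside cs ⟧
      inside-⊇ (c ∷ cs) c∈ c⊆P p with em {P = ⟦ c ⟧ ⊆ P}
      inside-⊇ (c ∷ cs) (here refl) c⊆P p | yes _ = inj₁ p
      inside-⊇ (c ∷ cs) (there c∈)  c⊆P p | yes _ = inj₂ (inside-⊇ cs c∈ c⊆P p)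
      inside-⊇ (c ∷ cs) (here refl) c⊆P p | no ¬⊆ = ⊥-elim (¬⊆ c⊆P)
      inside-⊇ (c ∷ cs) (there c∈)  c⊆P p | no _  = inside-⊇ cs c∈ c⊆P p

      -- Each point of an open set has a basic neighbourhood inside it; the code of that
      -- neighbourhood appears in some `codes k`, where `inside` keeps it.
      open-⋃ : IsOpen P → ⋃ ℕ (λ k → ⟦ inside (codes k) ⟧) ≐ P
      open-⋃ o = (λ (k , p) → inside-⊆ (codes k) p) , λ {z} p →
        let xs , near = o z p
            k , c∈    = codes-complete (comp (away z xs))
        in k , inside-⊇ (codes k) c∈ (λ {z′} ¬a → near z′ (¬away z xs ¬a)) (away-self z xs)

    -- Borel sets as I-limits of clopen sets

    -- All f above h must work, not only h itself, because `slow-function` supplies some function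
    -- above a given one but does not let it be prescribed.
    record Approximation (B : Pred (X → Code) 0ℓ) : Set where
      field
        U       : X → Code
        error   : (ℕ → ℕ) → Subset X
        error∈  : ∀ f → Mem I (error f)
        correct : ∀ z → Σ[ h ∈ (ℕ → ℕ) ] (∀ f → (∀ n → h n ≤ f n) →
                    ∀ x → ¬ T (error f x) → ⟦ U x ⟧ z ⇔ B z)

    open Approximation

    clopen-approx : ∀ c → Approximation ⟦ c ⟧
    clopen-approx c = record
      { U       = λ _ → c
      ; error   = λ _ _ → false
      ; error∈  = λ _ → I.finite [] λ _ ()
      ; correct = λ z → (λ _ → 0) , λ _ _ _ _ → mk⇔ id id
      }

    compl-approx : ∀ {B} → Approximation B → Approximation (∁ B)
    compl-approx a = record
      { U       = λ x → comp (U a x)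
      ; error   = error a
      ; error∈  = error∈ a
      ; correct = λ z → let h , ok = correct a z in h , λ f h≤f x x∉ →
          let e = ok f h≤f x x∉ in mk⇔ (_∘ from e) (_∘ to e)
      }

    resp-approx : ∀ {B C} → B ≐ C → Approximation B → Approximation C
    resp-approx (l , r) a = record
      { U       = U a
      ; error   = error a
      ; error∈  = error∈ a
      ; correct = λ z → let h , ok = correct a z in h , λ f h≤f x x∉ →
          let e = ok f h≤f x x∉ in mk⇔ (λ p → l (to e p)) (λ p → from e (r p))
      }

    ⋃<ᶜ : (ℕ → Code) → ℕ → Code
    ⋃<ᶜ c zero    = none
    ⋃<ᶜ c (suc k) = c k ∪ᶜ ⋃<ᶜ c k

    ∈-⋃<ᶜ : ∀ c k {z} → ⟦ ⋃<ᶜ c k ⟧ z ⇔ (∃[ i ] i < k × ⟦ c i ⟧ z)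
    ∈-⋃<ᶜ c k = mk⇔ (elim k) (λ (i , i<k , p) → intro k i<k p)
      where
      elim : ∀ k {z} → ⟦ ⋃<ᶜ c k ⟧ z → ∃[ i ] i < k × ⟦ c i ⟧ z
      elim (suc k) (inj₁ p) = k , ≤-refl , p
      elim (suc k) (inj₂ p) = let i , i<k , q = elim k p in i , m<n⇒m<1+n i<k , q

      intro : ∀ k {i z} → i < k → ⟦ c i ⟧ z → ⟦ ⋃<ᶜ c k ⟧ z
      intro (suc k) i<sk p with m≤n⇒m<n∨m≡n (m<1+n⇒m≤n i<sk)
      ... | inj₁ i<k  = inj₂ (intro k i<k p)
      ... | inj₂ refl = inj₁ p

    module _ (𝔟≰𝔡 : ¬ (𝔟 ax I ≤ᶜ 𝔡 ax)) where

      -- One f serves all i at once through its shifts f (i + _): any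
      -- sequence h₀, h₁, … is dominated by the shifts of some f.
      union-approx : ∀ {P : ℕ → Pred (X → Code) 0ℓ} → (∀ i → Approximation (P i)) →
                     Approximation (⋃ ℕ P)
      union-approx {P} a = record
        { U       = λ x → ⋃<ᶜ (λ i → U (a i) x) (g x)
        -- Outside the second set `h 0 < g x`, and `bound` forces `k z ≤ h 0`; so an index
        -- witnessing that z is in the union survives the cut at `g x`.
        ; error   = λ h x → M h x ∨ below g (suc (h 0)) x
        ; error∈  = λ h → I.∪-closed (M∈ h) (⋃<-∈ g∈ (suc (h 0)))
        ; correct = λ z → bound z , λ h b≤h x x∉ →
            let x∉₁ , x∉₂ = ∉-∪ (M h) (below g (suc (h 0))) x∉
                k<g : k z < g x
                k<g = ≤-<-trans (≤-trans (m≤m+n (k z) _) (b≤h 0)) (below-∉ g (suc (h 0)) x∉₂)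
                good : ∀ i → i < g x → ⟦ U (a i) x ⟧ z ⇔ P i z
                good i i<g = proj₂ (correct (a i) z) _
                  (λ n → ≤-trans (bound-shift z i n) (≤-trans (b≤h (i + n)) (h≤F h (i + n)))) x
                  (avoids h x x∉₁ i i<g)
            in mk⇔ (λ p → let i , i<g , q = to (∈-⋃<ᶜ _ (g x)) p in i , to (good i i<g) q)
                   (λ p → from (∈-⋃<ᶜ _ (g x)) (k z , k<g , from (good (k z) k<g) (reached z p)))
        }
        where
        slow = slow-function 𝔟≰𝔡 (λ f i → error (a i) (λ n → f (i + n)))
                                 (λ f i → error∈ (a i) (λ n → f (i + n)))

        g : X → ℕ
        g = proj₁ slow

        g∈ : 𝒟 I g
        g∈ = proj₁ (proj₂ slow)

        F : (ℕ → ℕ) → ℕ → ℕ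
        F h = proj₁ (proj₂ (proj₂ slow) h)

        h≤F : ∀ h n → h n ≤ F h n
        h≤F h = proj₁ (proj₂ (proj₂ (proj₂ slow) h))

        M : (ℕ → ℕ) → Subset X
        M h = proj₁ (proj₂ (proj₂ (proj₂ (proj₂ slow) h)))

        M∈ : ∀ h → Mem I (M h)
        M∈ h = proj₁ (proj₂ (proj₂ (proj₂ (proj₂ (proj₂ slow) h))))

        avoids : ∀ h x → ¬ T (M h x) → ∀ i → i < g x → ¬ T (error (a i) (λ n → F h (i + n)) x)
        avoids h = proj₂ (proj₂ (proj₂ (proj₂ (proj₂ (proj₂ slow) h))))

        -- The implication gives every z an index; 0 is a dummy for z outside the union.
        witness : ∀ z → ∃[ k ] ((∃[ i ] P i z) → P k z)
        witness z with em {P = ∃[ i ] P i z}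
        ... | yes (i , p) = i , λ _ → p
        ... | no ∄        = 0 , λ p → ⊥-elim (∄ p)

        k : (X → Code) → ℕ
        k z = proj₁ (witness z)

        reached : ∀ z → (∃[ i ] P i z) → P (k z) z
        reached z = proj₂ (witness z)

        h : (X → Code) → ℕ → ℕ → ℕ
        h z i = proj₁ (correct (a i) z)

        -- The sum of all `h i j` with i + j = n, hence a bound for each of them.
        antidiagonal : (ℕ → ℕ → ℕ) → ℕ → ℕ
        antidiagonal h zero    = h 0 0
        antidiagonal h (suc n) = h 0 (suc n) + antidiagonal (λ i → h (suc i)) n

        antidiagonal-≥ : ∀ h i n → h i n ≤ antidiagonal h (i + n)
        antidiagonal-≥ h zero zero    = ≤-refl
        antidiagonal-≥ h zero (suc n) = m≤m+n _ _
        antidiagonal-≥ h (suc i) n    = ≤-trans (antidiagonal-≥ (λ i → h (suc i)) i n) (m≤n+m _ _)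

        bound : (X → Code) → ℕ → ℕ
        bound z n = k z + antidiagonal (h z) n

        bound-shift : ∀ z i n → h z i n ≤ bound z (i + n)
        bound-shift z i n = ≤-trans (antidiagonal-≥ (h z) i n) (m≤n+m _ (k z))

      approximation : ∀ {B} → Borel B → Approximation B
      approximation (isOpen {P} o) =
        resp-approx (open-⋃ P o) (union-approx λ k → clopen-approx (inside P (codes k)))
      approximation (compl b)  = compl-approx (approximation b)
      approximation (union b)  = union-approx λ i → approximation (b i)
      approximation (resp e b) = resp-approx e (approximation b)

      -- Off `err`, x is in `eval V` iff V satisfies its own code `V x`, iff `S (eval V)`, which
      -- does not depend on x. If S holds of `eval V`, that set is in the dual, against
      -- disjointness; if not, it is in I and hence in S.
      not-separated : ¬ Separated (Mem I) (Dual I)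
      not-separated (S , b , I⊆S , disjoint) = ¬B ¬¬B
        where
        a : Approximation (λ z → S (eval z))
        a = approximation (preimage-Borel eval-continuous b)

        V : X → Code
        V = U a

        err : Subset X
        err = error a (proj₁ (correct a V))

        eval-V : ∀ x → ¬ T (err x) → T (eval V x) ⇔ S (eval V)
        eval-V x x∉ = let e = proj₂ (correct a V) _ (λ _ → ≤-refl) x x∉
                          d = T-⟪⟫ (λ x → ⟦ V x ⟧ V)
                      in mk⇔ (to e ∘ to d) (from d ∘ from e)

        ¬B : ¬ S (eval V)
        ¬B s = disjoint (eval V)
          ( I.⊆-closed (λ x t → ¬¬-elim λ x∉ → T-not t (from (eval-V x x∉) s)) (error∈ a _)
          , s)
          where
          T-not : ∀ {b} → T (not b) → ¬ T b
          T-not {false} _ ()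

        ¬¬B : S (eval V)
        ¬¬B = ¬¬-elim λ ¬s →
          ¬s (I⊆S (I.⊆-closed (λ x t → ¬¬-elim λ x∉ → ¬s (to (eval-V x x∉) t)) (error∈ a _)))

    separated⇒𝔟≤𝔡 : Separated (Mem I) (Dual I) → 𝔟 ax I ≤ᶜ 𝔡 ax
    separated⇒𝔟≤𝔡 s = ¬¬-elim λ 𝔟≰𝔡 → not-separated 𝔟≰𝔡 s

  -- Complementing φ pointwise maps Baire space continuously onto the dual. The two ranges are
  -- disjoint, since a set and its complement both in I would put the whole space in I; so `lusin`
  -- applies.
  analytic⇒separated : {X : Set} (I : Ideal X) → Analytic (Mem I) → Separated (Mem I) (Dual I)
  analytic⇒separated I (inj₁ empty) =
    ⊥-elim (empty (λ _ → false) (Ideal.finite I [] λ _ ()))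
  analytic⇒separated I (inj₂ (φ , c , range)) =
    sep-⊆ (λ {A} → to (range A)) (λ {A} A∈ → let α , eq = to (range _) A∈ in
        α , λ x → trans (cong not (eq x)) (not-involutive (A x)))
      (lusin c ¬φ-continuous λ α β eq → Ideal.proper I (Ideal.⊆-closed I
        (λ x _ → covers (φ β x) (eq x))
        (Ideal.∪-closed I (member α) (member β))))
    where
    member : ∀ α → Mem I (φ α)
    member α = from (range (φ α)) (α , λ _ → refl)

    ¬φ-continuous : Continuous (λ α x → not (φ α x))
    ¬φ-continuous P o = c (λ A → P (λ x → not (A x))) λ A p →
      let xs , near = o _ p in xs , λ B eq → near _ (All.map (cong not) eq)

    covers : ∀ b {a} → a ≡ not b → T (a ∨ b)
    covers true  refl = tt
    covers false refl = tt

corollary5p5 : (ax : Classical) →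
    ((I : Ideal ℕ) → BorelSeparated I → 𝔟 ax I ≤ᶜ 𝔡 ax)
    × ((X : Set) → X ↣ ℕ → (I : Ideal X) → Analytic (Mem I) → 𝔟 ax I ≤ᶜ 𝔡 ax)
corollary5p5 ax =
  (λ I → separated⇒𝔟≤𝔡 (↣-id ℕ) I) ,
  (λ X ι I → separated⇒𝔟≤𝔡 ι I ∘ analytic⇒separated I)
  where open Classically ax
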